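{- Let $r \geq 2$ be an integer, $m = r^{\binom{r+1}{2}} - r^{\binom{r}{2}} + 1$ and $n = r^{r-1}(r^r - 1) + r + 1$. Then $g(m,n) \geq r+1$.
   Context: For positive integers $m,n$, the grid graph $\Gamma_{m,n} = K_m \times K_n$ has vertex set $[m]\times[n]$ (where $[k]=\{1,\dots,k\}$), and two distinct vertices $(i,j)$, $(i',j')$ are adjacent if and only if $i=i'$ or $j=j'$. A rectangle is a set of four vertices $\{(i,j),(i',j),(i,j'),(i',j')\}$ with $1\le i<i'\le m$ and $1\le j<j'\le n$. Given a colouring of $E(\Gamma_{m,n})$, a rectangle is called alternating if its parallel edges receive the same colour, that is, the edges $\{(i,j),(i',j)\}$ and $\{(i,j'),(i',j')\}$ have the same colour, and the edges $\{(i,j),(i,j')\}$ and $\{(i',j),(i',j')\}$ have the same colour. An $r$-colouring is an arbitrary (not necessarily proper) assignment of colours from a set of $r$ colours. For positive integers $m,n$, $g(m,n)$ is the smallest number $r$ such that there exists an $r$-colouring of $E(\Gamma_{m,n})$ without alternating rectangles. -}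

module Defs where

open import Data.Fin as Fin using (Fin; zero; toℕ; fromℕ<; combine; remQuot; finToFun; funToFin)
import Data.Fin.Properties as Fin
open import Data.Nat using (ℕ; zero; suc; _+_; _*_; _^_; _≤_; z≤n; s≤s)
import Data.Nat.Properties as ℕ
open import Data.Product using (∃; ∃-syntax; _×_; _,_; proj₁; proj₂)
open import Data.Product.Properties using (≡-dec)
open import Data.Sum using (_⊎_; inj₁; inj₂)
open import Function using (_∘_)
open import Level using (0ℓ)
open import Relation.Binary.PropositionalEquality
  using (_≡_; _≢_; refl; sym; trans; cong; cong₂)
open import Relation.Nullary using (¬_; Dec; yes; no; contradiction)
open import Relation.Nullary.Decidable using (map′; ¬?; _×-dec_; _⊎-dec_; _→-dec_)
open import Relation.Nullary.Negation using (contradiction-irr)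
open import Relation.Unary using (Pred; Decidable)

Vertex : ℕ → ℕ → Set
Vertex m n = Fin m × Fin n

-- Adjacency in the grid graph K_m × K_n.
Adjacent : ∀ {m n} → Vertex m n → Vertex m n → Set
Adjacent u v = u ≢ v × (proj₁ u ≡ proj₁ v ⊎ proj₂ u ≡ proj₂ v)

-- An edge is an unordered pair of adjacent vertices, so an assignment of
-- colours to edges is a function on ordered adjacent pairs that ignores the
-- order of the pair and the evidence of adjacency.
record Colouring (m n r : ℕ) : Set where
  field
    colour    : (u v : Vertex m n) → .(Adjacent u v) → Fin r
    symmetric : ∀ u v .(a : Adjacent u v) .(b : Adjacent v u) →
                colour u v a ≡ colour v u b

record Rectangle (m n : ℕ) : Set where
  constructor rectangle
  field
    {i i′} : Fin m
    {j j′} : Fin n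
    i<i′   : i Fin.< i′
    j<j′   : j Fin.< j′

adjacent-vary₁ : ∀ {m n} {i i′ : Fin m} → i Fin.< i′ → (j : Fin n) →
                 Adjacent (i , j) (i′ , j)
adjacent-vary₁ i<i′ j = Fin.<⇒≢ i<i′ ∘ cong proj₁ , inj₂ refl

adjacent-vary₂ : ∀ {m n} {j j′ : Fin n} (i : Fin m) → j Fin.< j′ →
                 Adjacent (i , j) (i , j′)
adjacent-vary₂ i j<j′ = Fin.<⇒≢ j<j′ ∘ cong proj₂ , inj₁ refl

Alternating : ∀ {m n r} → Colouring m n r → Rectangle m n → Set
Alternating c R =
    colour (i , j) (i′ , j) (adjacent-vary₁ i<i′ j)
      ≡ colour (i , j′) (i′ , j′) (adjacent-vary₁ i<i′ j′)
  × colour (i , j) (i , j′) (adjacent-vary₂ i j<j′)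
      ≡ colour (i′ , j) (i′ , j′) (adjacent-vary₂ i′ j<j′)
  where
  open Colouring c
  open Rectangle R

HasAlternatingFreeColouring : ℕ → ℕ → ℕ → Set
HasAlternatingFreeColouring m n r =
  ∃[ c ] ((R : Rectangle m n) → ¬ Alternating {m} {n} {r} c R)

IsSmallest : Pred ℕ 0ℓ → Pred ℕ 0ℓ
IsSmallest P k = P k × (∀ j → P j → k ≤ j)

smallest : ∀ {P : Pred ℕ 0ℓ} → Decidable P → ∃ P → ∃ (IsSmallest P)
smallest {P} P? (k , pk) = go k P? pk
  where
  go : ∀ k {P : Pred ℕ 0ℓ} → Decidable P → P k → ∃ (IsSmallest P)
  go zero    P? pk = zero , pk , λ _ _ → z≤n
  go (suc k) P? pk with P? zero
  ... | yes p₀ = zero , p₀ , λ _ _ → z≤n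
  ... | no ¬p₀ with go k (P? ∘ suc) pk
  ...   | l , pl , least = suc l , pl , λ where
            zero    p → contradiction p ¬p₀
            (suc j) p → s≤s (least j p)

-- Colouring an edge by the sum of the second coordinates of its ends avoids
-- alternating rectangles: parallel edges with second coordinates j , j and
-- j′ , j′ get the distinct colours 2j and 2j′.
alternatingFreeColouring : ∀ m n → HasAlternatingFreeColouring m n (n + n)
alternatingFreeColouring m n = c , alternating-free
  where
  bound : (j j′ : Fin n) → suc (toℕ j + toℕ j′) ≤ n + n
  bound j j′ = ℕ.+-mono-<-≤ (Fin.toℕ<n j) (ℕ.<⇒≤ (Fin.toℕ<n j′))

  c : Colouring m n (n + n)
  c = record
    { colour    = λ u v _ → fromℕ< (bound (proj₂ u) (proj₂ v))
    ; symmetric = λ u v _ _ →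
        Fin.fromℕ<-cong _ _ (ℕ.+-comm (toℕ (proj₂ u)) (toℕ (proj₂ v))) _ _
    }

  alternating-free : (R : Rectangle m n) → ¬ Alternating c R
  alternating-free (rectangle {j = j} {j′ = j′} _ j<j′) (same , _) =
    ℕ.<⇒≢ (ℕ.+-mono-< j<j′ j<j′)
      (Fin.fromℕ<-injective _ _ (bound j j) (bound j′ j′) same)

allVertices? : ∀ {m n} {P : Pred (Vertex m n) 0ℓ} → Decidable P → Dec (∀ u → P u)
allVertices? P? = map′ (λ p (i , j) → p i j) (λ p i j → p (i , j))
  (Fin.all? λ i → Fin.all? λ j → P? (i , j))

adjacent? : ∀ {m n} (u v : Vertex m n) → Dec (Adjacent u v)
adjacent? u v = ¬? (≡-dec Fin._≟_ Fin._≟_ u v)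
  ×-dec (proj₁ u Fin.≟ proj₁ v ⊎-dec proj₂ u Fin.≟ proj₂ v)

-- Decided by exhausting the finitely many symmetric functions from all ordered
-- pairs of vertices to the colours; with at least one colour, every colouring
-- extends to such a function.
hasAlternatingFreeColouring? : ∀ m n → Decidable (HasAlternatingFreeColouring m n)
hasAlternatingFreeColouring? m n zero = map′ from to
  (allVertices? λ u → allVertices? λ v → ¬? (adjacent? u v))
  where
  from : ((u v : Vertex m n) → ¬ Adjacent u v) → HasAlternatingFreeColouring m n zero
  from edgeless =
    record { colour    = λ u v a → contradiction-irr a (edgeless u v)
           ; symmetric = λ u v a _ → contradiction-irr a (edgeless u v) }
    , λ (rectangle {i = i} _ j<j′) _ → edgeless _ _ (adjacent-vary₂ i j<j′)

  to : HasAlternatingFreeColouring m n zero → (u v : Vertex m n) → ¬ Adjacent u v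
  to (c , _) u v a = Fin.¬Fin0 (Colouring.colour c u v a)
hasAlternatingFreeColouring? m n (suc r) = map′ from to
  (Fin.any? (good? ∘ decode))
  where
  N : ℕ
  N = (m * n) * (m * n)

  PairColouring : Set
  PairColouring = Vertex m n → Vertex m n → Fin (suc r)

  vertex : Fin (m * n) → Vertex m n
  vertex = remQuot n

  decode : Fin (suc r ^ N) → PairColouring
  decode k (i , j) (i′ , j′) = finToFun k (combine (combine i j) (combine i′ j′))

  encode : PairColouring → Fin (suc r ^ N)
  encode f = funToFin λ k → let (u , v) = remQuot (m * n) k in f (vertex u) (vertex v)

  decode-encode : ∀ f u v → decode (encode f) u v ≡ f u v
  decode-encode f (i , j) (i′ , j′) = trans
    (Fin.finToFun-funToFin _ (combine (combine i j) (combine i′ j′)))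
    (trans (cong (λ (u , v) → f (vertex u) (vertex v))
                 (Fin.remQuot-combine (combine i j) (combine i′ j′)))
           (cong₂ f (Fin.remQuot-combine i j) (Fin.remQuot-combine i′ j′)))

  Good : Pred PairColouring 0ℓ
  Good f = (∀ u v → f u v ≡ f v u)
         × (∀ i i′ j j′ → i Fin.< i′ → j Fin.< j′ →
            ¬ (f (i , j) (i′ , j) ≡ f (i , j′) (i′ , j′)
             × f (i , j) (i , j′) ≡ f (i′ , j) (i′ , j′)))

  good? : Decidable Good
  good? f = (allVertices? λ u → allVertices? λ v → f u v Fin.≟ f v u)
    ×-dec (Fin.all? λ i → Fin.all? λ i′ → Fin.all? λ j → Fin.all? λ j′ →
      i Fin.<? i′ →-dec j Fin.<? j′ →-dec
      ¬? (f (i , j) (i′ , j) Fin.≟ f (i , j′) (i′ , j′)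
          ×-dec f (i , j) (i , j′) Fin.≟ f (i′ , j) (i′ , j′)))

  good-resp : ∀ {f g} → (∀ u v → f u v ≡ g u v) → Good g → Good f
  good-resp f≗g (sym-g , free) =
    (λ u v → trans (f≗g u v) (trans (sym-g u v) (sym (f≗g v u)))) ,
    (λ i i′ j j′ i<i′ j<j′ (p , q) → free i i′ j j′ i<i′ j<j′
      ( trans (sym (f≗g _ _)) (trans p (f≗g _ _))
      , trans (sym (f≗g _ _)) (trans q (f≗g _ _))))

  from : ∃ (Good ∘ decode) → HasAlternatingFreeColouring m n (suc r)
  from (k , sym-k , free) =
    record { colour    = λ u v _ → decode k u v
           ; symmetric = λ u v _ _ → sym-k u v }
    , λ (rectangle i<i′ j<j′) → free _ _ _ _ i<i′ j<j′

  to : HasAlternatingFreeColouring m n (suc r) → ∃ (Good ∘ decode)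
  to (c , free) = encode extension , good-resp (decode-encode extension) good
    where
    open Colouring c

    extension : PairColouring
    extension u v with adjacent? u v
    ... | yes a = colour u v a
    ... | no  _ = zero

    extends : ∀ u v (a : Adjacent u v) → extension u v ≡ colour u v a
    extends u v a with adjacent? u v
    ... | yes _ = refl
    ... | no ¬a = contradiction a ¬a

    swap : ∀ {u v : Vertex m n} → Adjacent u v → Adjacent v u
    swap (u≢v , inj₁ p) = u≢v ∘ sym , inj₁ (sym p)
    swap (u≢v , inj₂ p) = u≢v ∘ sym , inj₂ (sym p)

    extension-sym : ∀ u v → extension u v ≡ extension v u
    extension-sym u v with adjacent? u v | adjacent? v u
    ... | yes a | yes b = symmetric u v a b
    ... | yes a | no ¬b = contradiction (swap a) ¬b
    ... | no ¬a | yes b = contradiction (swap b) ¬a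
    ... | no _  | no _  = refl

    good : Good extension
    good = extension-sym , λ i i′ j j′ i<i′ j<j′ (p , q) →
      free (rectangle i<i′ j<j′)
        ( trans (sym (extends _ _ (adjacent-vary₁ i<i′ j)))
            (trans p (extends _ _ (adjacent-vary₁ i<i′ j′)))
        , trans (sym (extends _ _ (adjacent-vary₂ i j<j′)))
            (trans q (extends _ _ (adjacent-vary₂ i′ j<j′))))

g-smallest : ∀ m n → ∃ (IsSmallest (HasAlternatingFreeColouring m n))
g-smallest m n = smallest (hasAlternatingFreeColouring? m n)
                          (n + n , alternatingFreeColouring m n)

g : ℕ → ℕ → ℕ
g m n = proj₁ (g-smallest m n)

g-isSmallest : ∀ m n → IsSmallest (HasAlternatingFreeColouring m n) (g m n)
g-isSmallest m n = proj₂ (g-smallest m n)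

{-# OPTIONS --safe #-}

-- Write q = r ^ r and K = r ^ (r ∸ 1) * (q ∸ 1) + 1, and suppose an r-colouring
-- has no alternating rectangle.  Two rows cannot agree on all edges inside r + 1
-- columns: among these columns two have equally coloured edges between the rows.
-- Fix a set Q of r ∸ 1 columns.  By pigeonhole, K rows agree inside Q.  For each
-- of the K + 1 columns v outside Q, at least q of these K rows agree also on the
-- edges from v to Q; call this set of rows S v.  For v ≢ v′, rows in S v ∩ S v′
-- have distinct colours on the edge v v′, so ∣ S v ∩ S v′ ∣ ≤ r.  Double counting
-- shows that K + 1 such subsets of a K-set do not exist when q > r.

module Submission where

open import Defs
import Algebra.Properties.Semiring.Sum
open import Data.Fin as Fin
  using (Fin; zero; suc; _↑ˡ_; _↑ʳ_; combine; finToFun; funToFin; inject≤; punchIn)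
import Data.Fin.Properties as Fin
open import Data.Nat
  using (ℕ; zero; suc; _+_; _*_; _∸_; _^_; _≤_; _<_; _≥_; z≤n; s≤s; s<s; _<?_)
open import Data.Nat.Combinatorics using (_C_; nC1≡n; nCk+nC[k+1]≡[n+1]C[k+1])
import Data.Nat.Properties as ℕ
open import Data.Nat.Tactic.RingSolver using (solve-∀)
open import Data.Product using (∃-syntax; _×_; _,_; proj₁; proj₂)
open import Data.Sum using (inj₁; inj₂)
open import Function using (_∘_; Injective)
open import Relation.Binary using (tri<; tri≈; tri>)
open import Relation.Binary.PropositionalEquality
  using (_≡_; _≢_; refl; sym; trans; cong; cong₂; subst; subst₂; module ≡-Reasoning)
open import Relation.Nullary using (¬_; Dec; yes; no; contradiction)
open import Relation.Nullary.Decidable using (_×-dec_; decidable-stable)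
open import Relation.Unary using (Decidable)

open Algebra.Properties.Semiring.Sum ℕ.+-*-semiring
  using (sum; sum-syntax; sum-remove; sum-cong-≗; ∑-distrib-+; ∑-comm; *-distribˡ-sum; *-distribʳ-sum)

-- Finite sums, indicators and pigeonhole counting.

sum-mono-≤ : ∀ {n} {f g : Fin n → ℕ} → (∀ i → f i ≤ g i) → sum f ≤ sum g
sum-mono-≤ {zero}  f≤g = z≤n
sum-mono-≤ {suc n} f≤g = ℕ.+-mono-≤ (f≤g zero) (sum-mono-≤ (f≤g ∘ suc))

sum-const : ∀ n c → ∑[ i < n ] c ≡ n * c
sum-const zero    c = refl
sum-const (suc n) c = cong (c +_) (sum-const n c)

term≤sum : ∀ {n} (f : Fin n → ℕ) i → f i ≤ sum f
term≤sum f zero    = ℕ.m≤m+n _ _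
term≤sum f (suc i) = ℕ.≤-trans (term≤sum (f ∘ suc) i) (ℕ.m≤n+m _ _)

-- Meant for a row of a matrix of inner products: the diagonal entry is kept, and only the other
-- entries are bounded.
sum-≤-except : ∀ {n r} (f : Fin (suc n) → ℕ) i →
               (∀ j → i ≢ j → f j ≤ r) → sum f ≤ f i + n * r
sum-≤-except {n} {r} f i f≤r = begin
  sum f                           ≡⟨ sum-remove {i = i} f ⟩
  f i + sum (f ∘ punchIn i)       ≤⟨ ℕ.+-monoʳ-≤ (f i) (sum-mono-≤ λ j →
                                       f≤r _ (Fin.punchInᵢ≢i i j ∘ sym)) ⟩
  f i + ∑[ j < n ] r              ≡⟨ cong (f i +_) (sum-const n r) ⟩
  f i + n * r                     ∎
  where open ℕ.≤-Reasoning

⟦_⟧ : {A : Set} → Dec A → ℕ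
⟦ yes _ ⟧ = 1
⟦ no _  ⟧ = 0

⟦⟧-true : ∀ {A : Set} (A? : Dec A) → A → 1 ≤ ⟦ A? ⟧
⟦⟧-true (yes _) _ = s≤s z≤n
⟦⟧-true (no ¬a) a = contradiction a ¬a

⟦⟧-× : ∀ {A B : Set} (A? : Dec A) (B? : Dec B) → ⟦ A? ⟧ * ⟦ B? ⟧ ≡ ⟦ A? ×-dec B? ⟧
⟦⟧-× (yes _) (yes _) = refl
⟦⟧-× (yes _) (no _)  = refl
⟦⟧-× (no _)  (yes _) = refl
⟦⟧-× (no _)  (no _)  = refl

⟦⟧-idem : ∀ {A : Set} (A? : Dec A) → ⟦ A? ⟧ * ⟦ A? ⟧ ≡ ⟦ A? ⟧
⟦⟧-idem (yes _) = refl
⟦⟧-idem (no _)  = refl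

count : ∀ {n} {P : Fin n → Set} → Decidable P → ℕ
count P? = sum λ i → ⟦ P? i ⟧

-- Supplies distinct witnesses: the pigeonhole principle in `count-≤` applies to them, and later
-- they are the `K` selected rows.
choose : ∀ {n k} {P : Fin n → Set} (P? : Decidable P) → k ≤ count P? →
         ∃[ f ] Injective {A = Fin k} _≡_ _≡_ f × (∀ a → P (f a))
choose {k = zero} P? _ = (λ ()) , (λ { {()} }) , λ ()
choose {n = suc n} {k = suc k} P? k≤ with P? zero
choose {suc n} {suc k} P? (s≤s k≤) | yes p with choose (P? ∘ suc) k≤
... | f , f-inj , Pf = f′ , f′-inj , Pf′
  where
  f′ : Fin (suc k) → Fin (suc n)
  f′ zero    = zero
  f′ (suc a) = suc (f a)

  f′-inj : Injective _≡_ _≡_ f′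
  f′-inj {zero}  {zero}  _  = refl
  f′-inj {suc a} {suc b} eq = cong suc (f-inj (Fin.suc-injective eq))

  Pf′ : ∀ a → _
  Pf′ zero    = p
  Pf′ (suc a) = Pf a
choose {suc n} {suc k} P? k≤ | no _ with choose (P? ∘ suc) k≤
... | f , f-inj , Pf = suc ∘ f , f-inj ∘ Fin.suc-injective , Pf

count-≤ : ∀ {n c} {P : Fin n → Set} (P? : Decidable P) (e : Fin n → Fin c) →
          (∀ {i j} → P i → P j → e i ≡ e j → i ≡ j) → count P? ≤ c
count-≤ {c = c} P? e e-inj = ℕ.≮⇒≥ λ c<count →
  let f , f-inj , Pf    = choose P? c<count
      a , b , a<b , same = Fin.pigeonhole (ℕ.n<1+n c) (e ∘ f)
  in Fin.<⇒≢ a<b (f-inj (e-inj (Pf a) (Pf b) same))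

count-∩-≤ : ∀ {n c} {P Q : Fin n → Set} (P? : Decidable P) (Q? : Decidable Q) (e : Fin n → Fin c) →
            (∀ {i j} → P i × Q i → P j × Q j → e i ≡ e j → i ≡ j) →
            ∑[ i < n ] (⟦ P? i ⟧ * ⟦ Q? i ⟧) ≤ c
count-∩-≤ {c = c} P? Q? e e-inj =
  subst (_≤ c) (sym (sum-cong-≗ λ i → ⟦⟧-× (P? i) (Q? i)))
    (count-≤ (λ i → P? i ×-dec Q? i) e e-inj)

-- If every fibre had at most `k` elements, the `B` fibres, which cover all `n` arguments, would
-- hold at most `B * k` of them.
popularFibre : ∀ {n B k} (f : Fin n → Fin B) → B * k < n →
               ∃[ y ] k < count (λ i → f i Fin.≟ y)
popularFibre {n} {B} {k} f Bk<n = decidable-stable (Fin.any? λ y → k <? fibre y) λ none →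
  ℕ.<⇒≱ Bk<n (begin
    n                                          ≡⟨ ℕ.*-identityʳ n ⟨
    n * 1                                      ≡⟨ sum-const n 1 ⟨
    ∑[ i < n ] 1                               ≤⟨ sum-mono-≤ (λ i → ℕ.≤-trans
                                                    (⟦⟧-true (f i Fin.≟ f i) refl)
                                                    (term≤sum (λ y → ⟦ f i Fin.≟ y ⟧) (f i))) ⟩
    ∑[ i < n ] ∑[ y < B ] ⟦ f i Fin.≟ y ⟧      ≡⟨ ∑-comm (λ i y → ⟦ f i Fin.≟ y ⟧) ⟩
    ∑[ y < B ] fibre y                         ≤⟨ sum-mono-≤ (λ y → ℕ.≮⇒≥ λ k< → none (y , k<)) ⟩
    ∑[ y < B ] k                               ≡⟨ sum-const B k ⟩
    B * k                                      ∎)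
  where
  open ℕ.≤-Reasoning
  fibre : Fin B → ℕ
  fibre y = count (λ i → f i Fin.≟ y)

-- Families of subsets with small pairwise intersections.

-- (d - q) (d - q - 1) ≥ 0, which holds for all integers.
consecutive-product : ∀ q d → (2 * q + 1) * d ≤ d * d + q * (q + 1)
consecutive-product q d with ℕ.≤-total d q
... | inj₁ d≤q with ℕ.m≤n⇒∃[o]m+o≡n d≤q
...   | k , refl = ℕ.m+n≤o⇒m≤o _ (ℕ.≤-reflexive (identity d k))
  where
  identity : ∀ d k → (2 * (d + k) + 1) * d + (k * k + k) ≡ d * d + (d + k) * ((d + k) + 1)
  identity = solve-∀
consecutive-product q d | inj₂ q≤d with ℕ.m≤n⇒∃[o]m+o≡n q≤d
...   | zero , refl  = ℕ.≤-reflexive (identity q)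
  where
  identity : ∀ q → (2 * q + 1) * (q + 0) ≡ (q + 0) * (q + 0) + q * (q + 1)
  identity = solve-∀
...   | suc k , refl = ℕ.m+n≤o⇒m≤o _ (ℕ.≤-reflexive (identity q k))
  where
  identity : ∀ q k → (2 * q + 1) * (q + suc k) + (k * k + k)
                     ≡ (q + suc k) * (q + suc k) + q * (q + 1)
  identity = solve-∀

-- The sets are given by their 0-1 incidence matrix x; the row sums of x are
-- bounded below, the inner products of distinct rows above.
setFamily-bound : ∀ {K q r} (x : Fin (suc K) → Fin K → ℕ) →
  (∀ v i → x v i * x v i ≡ x v i) →
  (∀ v → q ≤ ∑[ i < K ] x v i) →
  (∀ v w → v ≢ w → ∑[ i < K ] (x v i * x w i) ≤ r) →
  r * K + q ≡ q * q + r → q ≤ r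
-- The last hypothesis is r(K - 1) = q(q - 1), the parameter relation of a symmetric design. It
-- turns `qq≤rK` into q ≤ r.
setFamily-bound {K} {q} {r} x idem large small rK+q =
  ℕ.+-cancelˡ-≤ (q * q) q r (begin
    q * q + q   ≤⟨ ℕ.+-monoˡ-≤ q qq≤rK ⟩
    r * K + q   ≡⟨ rK+q ⟩
    q * q + r   ∎)
  where
  open ℕ.≤-Reasoning

  -- The degree of the point `i` in the family.
  d : Fin K → ℕ
  d i = ∑[ v < suc K ] x v i

  D : ℕ
  D = sum d

  D-large : suc K * q ≤ D
  D-large = begin
    suc K * q                          ≡⟨ sum-const (suc K) q ⟨
    ∑[ v < suc K ] q                   ≤⟨ sum-mono-≤ large ⟩
    ∑[ v < suc K ] ∑[ i < K ] x v i    ≡⟨ ∑-comm x ⟩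
    D                                  ∎

  inner : Fin (suc K) → Fin (suc K) → ℕ
  inner v w = ∑[ i < K ] (x v i * x w i)

  d²-expand : ∑[ i < K ] (d i * d i) ≡ ∑[ v < suc K ] ∑[ w < suc K ] inner v w
  d²-expand = begin-equality
    ∑[ i < K ] (d i * d i)
      ≡⟨ sum-cong-≗ (λ i → *-distribʳ-sum (d i) (λ v → x v i)) ⟩
    ∑[ i < K ] ∑[ v < suc K ] (x v i * d i)
      ≡⟨ ∑-comm (λ i v → x v i * d i) ⟩
    ∑[ v < suc K ] ∑[ i < K ] (x v i * d i)
      ≡⟨ sum-cong-≗ (λ v → sum-cong-≗ λ i → *-distribˡ-sum (x v i) (λ w → x w i)) ⟩
    ∑[ v < suc K ] ∑[ i < K ] ∑[ w < suc K ] (x v i * x w i)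
      ≡⟨ sum-cong-≗ (λ v → ∑-comm (λ i w → x v i * x w i)) ⟩
    ∑[ v < suc K ] ∑[ w < suc K ] inner v w
      ∎

  -- By `idem` the diagonal inner products are the set sizes, with total `D`; each of the K + 1 rows
  -- has `K` further terms, each at most `r`.
  d²-small : ∑[ i < K ] (d i * d i) ≤ D + suc K * (K * r)
  d²-small = begin
    ∑[ i < K ] (d i * d i)
      ≡⟨ d²-expand ⟩
    ∑[ v < suc K ] ∑[ w < suc K ] inner v w
      ≤⟨ sum-mono-≤ (λ v → sum-≤-except (inner v) v (small v)) ⟩
    ∑[ v < suc K ] (inner v v + K * r)
      ≡⟨ ∑-distrib-+ (λ v → inner v v) (λ _ → K * r) ⟩
    ∑[ v < suc K ] inner v v + ∑[ v < suc K ] (K * r)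
      ≡⟨ cong₂ _+_ (trans (sum-cong-≗ λ v → sum-cong-≗ (idem v)) (∑-comm x))
                   (sum-const (suc K) (K * r)) ⟩
    D + suc K * (K * r)
      ∎

  -- Summing `consecutive-product` over the points does the work of the Cauchy-Schwarz inequality:
  -- it bounds the sum of squared degrees from below by a linear function of `D`. The `D` from the
  -- diagonal cancels, which leaves the factor 2q.
  D-small : 2 * q * D ≤ suc K * (K * r) + K * (q * (q + 1))
  D-small = ℕ.+-cancelˡ-≤ D _ _ (begin
    D + 2 * q * D                                         ≡⟨ regroup D q ⟩
    (2 * q + 1) * D                                       ≡⟨ *-distribˡ-sum (2 * q + 1) d ⟩
    ∑[ i < K ] ((2 * q + 1) * d i)                        ≤⟨ sum-mono-≤ (λ i → consecutive-product q (d i)) ⟩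
    ∑[ i < K ] (d i * d i + q * (q + 1))                  ≡⟨ ∑-distrib-+ (λ i → d i * d i) (λ _ → q * (q + 1)) ⟩
    ∑[ i < K ] (d i * d i) + ∑[ i < K ] (q * (q + 1))     ≡⟨ cong (∑[ i < K ] (d i * d i) +_) (sum-const K (q * (q + 1))) ⟩
    ∑[ i < K ] (d i * d i) + K * (q * (q + 1))            ≤⟨ ℕ.+-monoˡ-≤ _ d²-small ⟩
    D + suc K * (K * r) + K * (q * (q + 1))               ≡⟨ ℕ.+-assoc D _ _ ⟩
    D + (suc K * (K * r) + K * (q * (q + 1)))             ∎)
    where
    regroup : ∀ D q → D + 2 * q * D ≡ (2 * q + 1) * D
    regroup = solve-∀

  qq≤rK : q * q ≤ r * K
  -- `D` is squeezed between `D-large` and `D-small`. Once r K + q is replaced by q q + r, the cubic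
  -- terms 2 K q q cancel.
  qq≤rK = ℕ.*-cancelˡ-≤ 2 (ℕ.+-cancelˡ-≤ (2 * (K * (q * q))) _ _ (begin
    2 * (K * (q * q)) + 2 * (q * q)                 ≡⟨ lhs K q ⟩
    2 * q * (suc K * q)                             ≤⟨ ℕ.*-monoʳ-≤ (2 * q) D-large ⟩
    2 * q * D                                       ≤⟨ D-small ⟩
    suc K * (K * r) + K * (q * (q + 1))             ≡⟨ mid K q r ⟩
    K * (r * K + q) + (K * r + K * (q * q))         ≡⟨ cong (λ z → K * z + (K * r + K * (q * q))) rK+q ⟩
    K * (q * q + r) + (K * r + K * (q * q))         ≡⟨ rhs K q r ⟩
    2 * (K * (q * q)) + 2 * (r * K)                 ∎))
    where
    lhs : ∀ K q → 2 * (K * (q * q)) + 2 * (q * q) ≡ 2 * q * (suc K * q)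
    lhs = solve-∀
    mid : ∀ K q r → suc K * (K * r) + K * (q * (q + 1)) ≡ K * (r * K + q) + (K * r + K * (q * q))
    mid = solve-∀
    rhs : ∀ K q r → K * (q * q + r) + (K * r + K * (q * q)) ≡ 2 * (K * (q * q)) + 2 * (r * K)
    rhs = solve-∀

-- Colourings as functions of rows and columns.

-- hor i j j′ is the colour of the edge (i , j) (i , j′), and ver i i′ j that of
-- (i , j) (i′ , j); the values at j ≡ j′ and at i ≡ i′ are junk.
record FreeGrid (m n r : ℕ) : Set where
  field
    hor  : Fin m → Fin n → Fin n → Fin r
    ver  : Fin m → Fin m → Fin n → Fin r
    free : ∀ {i i′ j j′} → i ≢ i′ → j ≢ j′ →
           ver i i′ j ≡ ver i i′ j′ → hor i j j′ ≢ hor i′ j j′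

module _ {m n r : ℕ} (c : Colouring m n (suc r)) where
  open Colouring c

  private
    hor : Fin m → Fin n → Fin n → Fin (suc r)
    hor i j j′ with j Fin.≟ j′
    -- The junk value needs a colour, hence `suc r` colours in this module.
    ... | yes _   = zero
    ... | no j≢j′ = colour (i , j) (i , j′) (j≢j′ ∘ cong proj₂ , inj₁ refl)

    ver : Fin m → Fin m → Fin n → Fin (suc r)
    ver i i′ j with i Fin.≟ i′
    ... | yes _   = zero
    ... | no i≢i′ = colour (i , j) (i′ , j) (i≢i′ ∘ cong proj₁ , inj₂ refl)

    -- `refl` suffices in the second case, as `colour` takes its adjacency proof irrelevantly.
    hor-colour : ∀ i {j j′} .(a : Adjacent (i , j) (i , j′)) → j ≢ j′ →
                 hor i j j′ ≡ colour (i , j) (i , j′) a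
    hor-colour i {j} {j′} a j≢j′ with j Fin.≟ j′
    ... | yes eq = contradiction eq j≢j′
    ... | no _   = refl

    ver-colour : ∀ {i i′} j .(a : Adjacent (i , j) (i′ , j)) → i ≢ i′ →
                 ver i i′ j ≡ colour (i , j) (i′ , j) a
    ver-colour {i} {i′} j a i≢i′ with i Fin.≟ i′
    ... | yes eq = contradiction eq i≢i′
    ... | no _   = refl

    hor-sym : ∀ i {j j′} → j ≢ j′ → hor i j j′ ≡ hor i j′ j
    hor-sym i j≢j′ = trans (hor-colour i adj j≢j′)
      (trans (symmetric _ _ adj adj′) (sym (hor-colour i adj′ (j≢j′ ∘ sym))))
      where
      adj  = j≢j′ ∘ cong proj₂ , inj₁ refl
      adj′ = j≢j′ ∘ sym ∘ cong proj₂ , inj₁ refl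

    ver-sym : ∀ {i i′} j → i ≢ i′ → ver i i′ j ≡ ver i′ i j
    ver-sym j i≢i′ = trans (ver-colour j adj i≢i′)
      (trans (symmetric _ _ adj adj′) (sym (ver-colour j adj′ (i≢i′ ∘ sym))))
      where
      adj  = i≢i′ ∘ cong proj₁ , inj₂ refl
      adj′ = i≢i′ ∘ sym ∘ cong proj₁ , inj₂ refl

  freeGrid : ((R : Rectangle m n) → ¬ Alternating c R) → FreeGrid m n (suc r)
  freeGrid alternating-free = record { hor = hor ; ver = ver ; free = free }
    where
    -- A `Rectangle` has its rows and columns in increasing order. Symmetry of the colouring then
    -- removes the order of the columns in `free-rows-<`, and that of the rows in `free`.
    free-< : ∀ {i i′ j j′} → i Fin.< i′ → j Fin.< j′ →
             ver i i′ j ≡ ver i i′ j′ → hor i j j′ ≢ hor i′ j j′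
    free-< {i} {i′} {j} {j′} i<i′ j<j′ p q = alternating-free (rectangle i<i′ j<j′)
      ( subst₂ _≡_ (ver-colour j (adjacent-vary₁ i<i′ j) i≢i′)
                   (ver-colour j′ (adjacent-vary₁ i<i′ j′) i≢i′) p
      , subst₂ _≡_ (hor-colour i (adjacent-vary₂ i j<j′) j≢j′)
                   (hor-colour i′ (adjacent-vary₂ i′ j<j′) j≢j′) q )
      where
      i≢i′ = Fin.<⇒≢ i<i′
      j≢j′ = Fin.<⇒≢ j<j′

    free-rows-< : ∀ {i i′ j j′} → i Fin.< i′ → j ≢ j′ →
                  ver i i′ j ≡ ver i i′ j′ → hor i j j′ ≢ hor i′ j j′
    free-rows-< {i} {i′} {j} {j′} i<i′ j≢j′ p q with Fin.<-cmp j j′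
    ... | tri< j<j′ _ _ = free-< i<i′ j<j′ p q
    ... | tri≈ _ j≡j′ _ = j≢j′ j≡j′
    ... | tri> _ _ j′<j = free-< i<i′ j′<j (sym p) (subst₂ _≡_ (hor-sym i j≢j′) (hor-sym i′ j≢j′) q)

    free : ∀ {i i′ j j′} → i ≢ i′ → j ≢ j′ →
           ver i i′ j ≡ ver i i′ j′ → hor i j j′ ≢ hor i′ j j′
    free {i} {i′} {j} {j′} i≢i′ j≢j′ p q with Fin.<-cmp i i′
    ... | tri< i<i′ _ _ = free-rows-< i<i′ j≢j′ p q
    ... | tri≈ _ i≡i′ _ = i≢i′ i≡i′
    ... | tri> _ _ i′<i = free-rows-< i′<i j≢j′ (subst₂ _≡_ (ver-sym j i≢i′) (ver-sym j′ i≢i′) p) (sym q)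

-- Lets the argument work with exactly `r` colours: an injection of colours creates no new
-- coincidences.
weaken : ∀ {m n k r} → k ≤ r →
         HasAlternatingFreeColouring m n k → HasAlternatingFreeColouring m n r
weaken k≤r (c , alternating-free) =
  record { colour    = λ u v a → inject≤ (colour u v a) k≤r
         ; symmetric = λ u v a b → cong (λ x → inject≤ x k≤r) (symmetric u v a b) }
  , λ R (p , q) → alternating-free R
      (Fin.inject≤-injective k≤r k≤r _ _ p , Fin.inject≤-injective k≤r k≤r _ _ q)
  where open Colouring c

-- For distinct rows, two of the r + 1 vertical edges share a colour; together with the agreeing
-- horizontal edges they form an alternating rectangle.
agreeing-rows-equal : ∀ {m n r} (G : FreeGrid m n r) (let open FreeGrid G)
  (X : Fin (suc r) → Fin n) → Injective _≡_ _≡_ X → ∀ {i i′} →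
  (∀ {a b} → a Fin.< b → hor i (X a) (X b) ≡ hor i′ (X a) (X b)) → i ≡ i′
agreeing-rows-equal {r = r} G X X-inj {i} {i′} agree = decidable-stable (i Fin.≟ i′) λ i≢i′ →
  let a , b , a<b , same = Fin.pigeonhole (ℕ.n<1+n r) (ver i i′ ∘ X)
  in free i≢i′ (Fin.<⇒≢ a<b ∘ X-inj) same (agree a<b)
  where open FreeGrid G

-- Encoding edge colourings of a complete graph.

-- Counts the edge colourings of a complete graph on `p` vertices. The recursion removes one vertex
-- with its star, so that `combine` can follow it.
cliqueColourings : ℕ → ℕ → ℕ
cliqueColourings r zero    = 1
cliqueColourings r (suc p) = r ^ p * cliqueColourings r p

-- Reads only the values `f a b` with a < b, one for each edge.
cliqueCode : ∀ {r} p → (Fin p → Fin p → Fin r) → Fin (cliqueColourings r p)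
cliqueCode zero    f = zero
cliqueCode (suc p) f =
  combine (funToFin λ b → f zero (suc b)) (cliqueCode p λ a b → f (suc a) (suc b))

funToFin-injective : ∀ {p r} {f g : Fin p → Fin r} → funToFin f ≡ funToFin g → ∀ a → f a ≡ g a
funToFin-injective {f = f} {g} eq a =
  trans (sym (Fin.finToFun-funToFin f a))
        (trans (cong (λ k → finToFun k a) eq) (Fin.finToFun-funToFin g a))

cliqueCode-injective : ∀ {r} p {f g : Fin p → Fin p → Fin r} →
  cliqueCode p f ≡ cliqueCode p g → ∀ {a b} → a Fin.< b → f a b ≡ g a b
cliqueCode-injective (suc p) eq {zero}  {suc b} _ =
  funToFin-injective (Fin.combine-injectiveˡ _ _ _ _ eq) b
cliqueCode-injective (suc p) {f} {g} eq {suc a} {suc b} (s<s a<b) =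
  cliqueCode-injective p
    (Fin.combine-injectiveʳ (funToFin λ b → f zero (suc b)) _
                            (funToFin λ b → g zero (suc b)) _ eq) a<b

cliqueColourings≡ : ∀ r p → cliqueColourings r p ≡ r ^ (p C 2)
cliqueColourings≡ r zero    = refl
cliqueColourings≡ r (suc p) = begin
  r ^ p * cliqueColourings r p   ≡⟨ cong (r ^ p *_) (cliqueColourings≡ r p) ⟩
  r ^ p * r ^ (p C 2)            ≡⟨ ℕ.^-distribˡ-+-* r p (p C 2) ⟨
  r ^ (p + p C 2)                ≡⟨ cong (λ k → r ^ (k + p C 2)) (nC1≡n p) ⟨
  r ^ (p C 1 + p C 2)            ≡⟨ cong (r ^_) (nCk+nC[k+1]≡[n+1]C[k+1] p 1) ⟩
  r ^ (suc p C 2)                ∎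
  where open ≡-Reasoning

-- The set family of a grid without alternating rectangles.

module _ {p q′ k m : ℕ} (G : FreeGrid m (p + suc (suc k)) (suc p))
  (many-rows : cliqueColourings (suc p) p * k < m)
  (many-stars : suc p ^ p * q′ < suc k) where
  open FreeGrid G

  private
    -- `p`, `q′` and `k` are r - 1, q - 1 and K - 1: `popularFibre` turns the strict bounds
    -- `many-rows` and `many-stars` into fibres of at least `K` and `q` elements.
    r q K : ℕ
    r = suc p
    q = suc q′
    K = suc k

    Q : Fin p → Fin (p + suc K)
    Q a = a ↑ˡ suc K

    column : Fin (suc K) → Fin (p + suc K)
    column v = p ↑ʳ v

    Q≢column : ∀ a v → Q a ≢ column v
    Q≢column a v eq with trans (sym (Fin.splitAt-↑ˡ p a (suc K)))
                               (trans (cong (Fin.splitAt p) eq) (Fin.splitAt-↑ʳ p (suc K) v))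
    ... | ()

    -- The columns of `v` and `w` and the r - 1 columns of `Q`: the r + 1 columns for
    -- `agreeing-rows-equal`.
    X : Fin (suc K) → Fin (suc K) → Fin (suc r) → Fin (p + suc K)
    X v w zero          = column v
    X v w (suc zero)    = column w
    X v w (suc (suc a)) = Q a

    X-injective : ∀ {v w} → v ≢ w → Injective _≡_ _≡_ (X v w)
    X-injective v≢w {zero}        {zero}        _  = refl
    X-injective v≢w {zero}        {suc zero}    eq = contradiction (Fin.↑ʳ-injective p _ _ eq) v≢w
    X-injective v≢w {zero}        {suc (suc b)} eq = contradiction (sym eq) (Q≢column b _)
    X-injective v≢w {suc zero}    {zero}        eq = contradiction (Fin.↑ʳ-injective p _ _ (sym eq)) v≢w
    X-injective v≢w {suc zero}    {suc zero}    _  = refl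
    X-injective v≢w {suc zero}    {suc (suc b)} eq = contradiction (sym eq) (Q≢column b _)
    X-injective v≢w {suc (suc a)} {zero}        eq = contradiction eq (Q≢column a _)
    X-injective v≢w {suc (suc a)} {suc zero}    eq = contradiction eq (Q≢column a _)
    X-injective v≢w {suc (suc a)} {suc (suc b)} eq =
      cong (λ c → suc (suc c)) (Fin.↑ˡ-injective (suc K) a b eq)

    Q-code : Fin m → Fin (cliqueColourings r p)
    Q-code i = cliqueCode p λ a b → hor i (Q a) (Q b)

    Q-fibre = popularFibre Q-code many-rows
    rows    = choose (λ i → Q-code i Fin.≟ proj₁ Q-fibre) (proj₂ Q-fibre)

    row : Fin K → Fin m
    row = proj₁ rows

    row-injective : Injective _≡_ _≡_ row
    row-injective = proj₁ (proj₂ rows)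

    rows-agree-on-Q : ∀ i i′ {a b} → a Fin.< b → hor (row i) (Q a) (Q b) ≡ hor (row i′) (Q a) (Q b)
    rows-agree-on-Q i i′ = cliqueCode-injective p
      (trans (proj₂ (proj₂ rows) i) (sym (proj₂ (proj₂ rows) i′)))

    star : Fin (suc K) → Fin K → Fin (r ^ p)
    star v i = funToFin λ a → hor (row i) (column v) (Q a)

    star-fibre : ∀ v → ∃[ y ] q′ < count (λ i → star v i Fin.≟ y)
    star-fibre v = popularFibre (star v) many-stars

    S : Fin (suc K) → Fin K → Set
    S v i = star v i ≡ proj₁ (star-fibre v)

    S? : ∀ v → Decidable (S v)
    S? v i = star v i Fin.≟ proj₁ (star-fibre v)

    same-star : ∀ {v i i′} → S v i → S v i′ →
                ∀ a → hor (row i) (column v) (Q a) ≡ hor (row i′) (column v) (Q a)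
    same-star s s′ = funToFin-injective (trans s (sym s′))

    -- Edges inside `Q` agree by the choice of rows, edges from `v` or `w` to `Q` by membership in
    -- `S`, and `same` covers the one remaining edge.
    S∩S-injective : ∀ {v w} → v ≢ w → ∀ {i i′} → S v i × S w i → S v i′ × S w i′ →
      hor (row i) (column v) (column w) ≡ hor (row i′) (column v) (column w) → i ≡ i′
    S∩S-injective {v} {w} v≢w {i} {i′} (sv , sw) (sv′ , sw′) same =
      row-injective (agreeing-rows-equal G (X v w) (X-injective v≢w) agree)
      where
      agree : ∀ {a b} → a Fin.< b →
              hor (row i) (X v w a) (X v w b) ≡ hor (row i′) (X v w a) (X v w b)
      agree {zero}        {suc zero}    _               = same
      agree {zero}        {suc (suc b)} _               = same-star sv sv′ b
      agree {suc zero}    {suc (suc b)} _               = same-star sw sw′ b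
      agree {suc zero}    {suc zero}    (s<s ())
      agree {suc (suc a)} {suc zero}    (s<s ())
      agree {suc (suc a)} {suc (suc b)} (s<s (s<s a<b)) = rows-agree-on-Q i i′ a<b

    S∩S-small : ∀ v w → v ≢ w → ∑[ i < K ] (⟦ S? v i ⟧ * ⟦ S? w i ⟧) ≤ r
    S∩S-small v w v≢w = count-∩-≤ (S? v) (S? w)
      (λ i → hor (row i) (column v) (column w)) (S∩S-injective v≢w)

  freeGrid-bound : r * K + q ≡ q * q + r → q ≤ r
  freeGrid-bound = setFamily-bound (λ v i → ⟦ S? v i ⟧) (λ v i → ⟦⟧-idem (S? v i))
    (proj₂ ∘ star-fibre) S∩S-small

-- The parameters of the theorem.

theorem1p4 : (r m n : ℕ) → r ≥ 2 →
    m ≡ (r ^ ((r + 1) C 2) ∸ r ^ (r C 2)) + 1 →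
    n ≡ r ^ (r ∸ 1) * (r ^ r ∸ 1) + r + 1 →
    g m n ≥ r + 1
theorem1p4 1 _ _ (s≤s ())
theorem1p4 r@(suc p@(suc _)) m n r≥2 m≡ n≡ = ℕ.≮⇒≥ λ g<r+1 →
  let g≤r = ℕ.≤-pred (subst (g m n <_) (ℕ.+-comm r 1) g<r+1)
      c , alternating-free = weaken g≤r (proj₁ (g-isSmallest m n))
      G = subst (λ k → FreeGrid m k r) n≡p+K+1 (freeGrid c alternating-free)
  -- With k = r ^ p * q′ both pigeonhole bounds are tight: `m` and `K` each exceed the product of
  -- boxes and box size by exactly one.
  in ℕ.<⇒≱ r<q (freeGrid-bound G (ℕ.≤-reflexive (sym m≡boxes+1)) ℕ.≤-refl rK+q)
  where
  open ≡-Reasoning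

  q′ : ℕ
  q′ = r ^ r ∸ 1

  q≡ : suc q′ ≡ r ^ r
  q≡ = ℕ.m+[n∸m]≡n (ℕ.m^n>0 r r)

  r<q : r < suc q′
  r<q = subst₂ _<_ (ℕ.*-identityʳ r) (sym q≡) (ℕ.^-monoʳ-< r r≥2 r≥2)

  n≡p+K+1 : n ≡ p + suc (suc (r ^ p * q′))
  n≡p+K+1 = trans n≡ (regroup (r ^ p * q′) p)
    where
    regroup : ∀ k p → k + suc p + 1 ≡ p + suc (suc k)
    regroup = solve-∀

  -- The exponents of the two powers differ by `r`, so their difference is r ^ r - 1 = q′ times the
  -- smaller power.
  m≡boxes+1 : m ≡ suc (cliqueColourings r p * (r ^ p * q′))
  m≡boxes+1 = begin
    m
      ≡⟨ m≡ ⟩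
    r ^ ((r + 1) C 2) ∸ r ^ (r C 2) + 1
      ≡⟨ ℕ.+-comm _ 1 ⟩
    suc (r ^ ((r + 1) C 2) ∸ r ^ (r C 2))
      ≡⟨ cong₂ (λ k l → suc (r ^ (k C 2) ∸ l)) (ℕ.+-comm r 1) (sym (cliqueColourings≡ r r)) ⟩
    suc (r ^ (suc r C 2) ∸ cliqueColourings r r)
      ≡⟨ cong (λ k → suc (k ∸ cliqueColourings r r)) (cliqueColourings≡ r (suc r)) ⟨
    suc (r ^ r * cliqueColourings r r ∸ cliqueColourings r r)
      ≡⟨ cong (λ k → suc (k * cliqueColourings r r ∸ cliqueColourings r r)) q≡ ⟨
    suc (suc q′ * cliqueColourings r r ∸ cliqueColourings r r)
      ≡⟨ cong suc (ℕ.m+n∸m≡n (cliqueColourings r r) _) ⟩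
    suc (q′ * (r ^ p * cliqueColourings r p))
      ≡⟨ cong suc (regroup q′ (r ^ p) (cliqueColourings r p)) ⟩
    suc (cliqueColourings r p * (r ^ p * q′))
      ∎
    where
    regroup : ∀ a b c → a * (b * c) ≡ c * (b * a)
    regroup = solve-∀

  -- Since r * r ^ p = r ^ r = q, the number K - 1 = r ^ p * q′ satisfies r(K - 1) = q(q - 1).
  rK+q : r * suc (r ^ p * q′) + suc q′ ≡ suc q′ * suc q′ + r
  rK+q = begin
    r * suc (r ^ p * q′) + suc q′      ≡⟨ expand r (r ^ p) q′ ⟩
    r + r ^ r * q′ + suc q′            ≡⟨ cong (λ z → r + z * q′ + suc q′) q≡ ⟨
    r + suc q′ * q′ + suc q′           ≡⟨ regroup r q′ ⟩
    suc q′ * suc q′ + r                ∎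
    where
    expand : ∀ r s q′ → r * suc (s * q′) + suc q′ ≡ r + (r * s) * q′ + suc q′
    expand = solve-∀
    regroup : ∀ r q′ → r + suc q′ * q′ + suc q′ ≡ suc q′ * suc q′ + r
    regroup = solve-∀
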